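{- The variety $\mathsf{CIdInRL}$ is not locally finite.
   Context: A commutative idempotent involutive residuated lattice is an algebra $\mathbf{A}=\langle A,\wedge,\vee,\cdot,\to,1,0\rangle$ such that $\langle A,\wedge,\vee\rangle$ is a lattice (with lattice order $\leq$), $\langle A,\cdot,1\rangle$ is a commutative monoid with $x\cdot x=x$ for all $x$, residuation holds ($x\cdot y\leq z \iff y\leq x\to z$), and, writing $-x := x\to 0$, one has $-{ - }x=x$ for all $x$. The class of these algebras, which is a variety, is $\mathsf{CIdInRL}$. A variety is locally finite if each of its finitely generated members is finite. -}

module Defs where

open import Level using (Level; _⊔_) renaming (suc to lsuc)
open import Data.List.Base using (List)
open import Data.Product.Base using (∃-syntax)
open import Function.Bundles using (_⇔_)
open import Algebra.Core using (Op₁; Op₂)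
open import Relation.Binary.Bundles using (Setoid)
import Algebra.Definitions as AlgDefs
import Algebra.Structures as AlgStr
import Algebra.Lattice.Structures as LatStr
import Data.List.Membership.Setoid as Membership
import Data.List.Relation.Unary.Enumerates.Setoid as Enumerates
import Relation.Binary.Construct.NaturalOrder.Left as NaturalOrder

private
  variable
    c ℓ p : Level

-- Algebras of type ⟨∧, ∨, ·, →, 1, 0⟩.  The carrier is a setoid, so equality
-- of elements is _≈_ and every operation has to respect it.
record Algebra (c ℓ : Level) : Set (lsuc (c ⊔ ℓ)) where
  infixr 7 _∙_
  infixr 6 _∧_
  infixr 5 _∨_ _⇒_
  field
    setoid : Setoid c ℓ

  open Setoid setoid public using (Carrier; _≈_)
  open AlgDefs _≈_ using (Congruent₂)

  field
    _∧_ _∨_ _∙_ _⇒_ : Op₂ Carrier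
    1# 0#           : Carrier
    ∧-cong          : Congruent₂ _∧_
    ∨-cong          : Congruent₂ _∨_
    ∙-cong          : Congruent₂ _∙_
    ⇒-cong          : Congruent₂ _⇒_

  -- The lattice order: x ≤ y unfolds to x ≈ x ∧ y.
  open NaturalOrder _≈_ _∧_ public using (_≤_)

  infix 8 -_
  -_ : Op₁ Carrier
  - x = x ⇒ 0#

-- The class of commutative idempotent involutive residuated lattices.  There
-- are no lattice bounds, and 0# is an arbitrary constant, not a least element.
record CIdInRL (A : Algebra c ℓ) : Set (c ⊔ ℓ) where
  open Algebra A
  open AlgDefs _≈_ using (Involutive)
  open AlgStr _≈_ using (IsIdempotentCommutativeMonoid)
  open LatStr _≈_ using (IsLattice)
  field
    isLattice                     : IsLattice _∨_ _∧_
    isIdempotentCommutativeMonoid : IsIdempotentCommutativeMonoid _∙_ 1#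
    residuated                    : ∀ x y z → (x ∙ y ≤ z) ⇔ (y ≤ x ⇒ z)
    involutive                    : Involutive -_

-- The subuniverse of A generated by the elements of the list gs.
data Sg (A : Algebra c ℓ) (gs : List (Algebra.Carrier A)) :
        Algebra.Carrier A → Set (c ⊔ ℓ) where
  gen  : ∀ {x} → Membership._∈_ (Algebra.setoid A) x gs → Sg A gs x
  resp : ∀ {x y} → Algebra._≈_ A x y → Sg A gs x → Sg A gs y
  meet : ∀ {x y} → Sg A gs x → Sg A gs y → Sg A gs (Algebra._∧_ A x y)
  join : ∀ {x y} → Sg A gs x → Sg A gs y → Sg A gs (Algebra._∨_ A x y)
  mul  : ∀ {x y} → Sg A gs x → Sg A gs y → Sg A gs (Algebra._∙_ A x y)
  res  : ∀ {x y} → Sg A gs x → Sg A gs y → Sg A gs (Algebra._⇒_ A x y)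
  one  : Sg A gs (Algebra.1# A)
  zero : Sg A gs (Algebra.0# A)

FinitelyGenerated : Algebra c ℓ → Set (c ⊔ ℓ)
FinitelyGenerated A = ∃[ gs ] (∀ x → Sg A gs x)

-- The enumerating list may contain repetitions, so no decidability of _≈_ is
-- built into finiteness.
Finite : Algebra c ℓ → Set (c ⊔ ℓ)
Finite A = ∃[ xs ] Enumerates.IsEnumeration (Algebra.setoid A) xs

LocallyFinite : (Algebra c ℓ → Set p) → Set (lsuc (c ⊔ ℓ) ⊔ p)
LocallyFinite K = ∀ A → K A → FinitelyGenerated A → Finite A

{-# OPTIONS --safe #-}
-- A commutative idempotent monoid M with a subset ⫫ closed under products
-- carries a phase semantics: put P^⫫ = {x | x∙p ∈ ⫫ for all p ∈ P}; the
-- subsets with P = P^⫫^⫫ form a CIdInRL.  Closure of ⫫ under products is what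
-- makes fusion idempotent.
--
-- Take for M the finite sets of tokens lo m and hi n under union, and for ⫫
-- the sets in which every hi n is covered by some lo m with m < n or m = n + 1.
-- Then Zₙ = {hi n}^⫫ consists of the members of ⫫ that cover hi n, and
--   Zₙ₊₃ = 1 ∧ (Zₙ₊₂ ⇒ (Zₙ ∨ Zₙ₊₁)),
-- a Rieger–Nishimura ladder in the negative cone.  So Z₀, Z₁, Z₂ generate all
-- the Zₙ, and these are distinct: for n < k, {lo (k + 1)} is in Zₖ but not in Zₙ.
module Submission where

open import Level using (Level; 0ℓ) renaming (suc to lsuc)
open import Relation.Nullary.Negation using (¬_)
open import Defs
open import Algebra.Bundles using (CommutativeMonoid; IdempotentCommutativeMonoid)
open import Algebra.Lattice.Structures using (module IsLattice)
open import Algebra.Structures using (module IsIdempotentCommutativeMonoid)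
open import Algebra.Structures.Biased using (isCommutativeMonoidˡ)
import Algebra.Properties.CommutativeSemigroup as CommutativeSemigroupₚ
open import Data.Empty using (⊥-elim)
open import Data.Fin.Base using (Fin; toℕ)
open import Data.Fin.Patterns using (0F; 1F; 2F)
open import Data.Fin.Properties using (pigeonhole)
open import Data.List.Base using (List; [_]; _++_; length; lookup; tabulate)
open import Data.List.Membership.Propositional using (_∈_)
open import Data.List.Membership.Propositional.Properties
  using (∈-++⁺ˡ; ∈-++⁺ʳ; ∈-++⁻)
open import Data.List.Membership.Setoid.Properties using (∈-tabulate⁺)
open import Data.List.Relation.Binary.BagAndSetEquality
  using (commutativeMonoid; ++-idempotent; set)
open import Data.List.Properties using (++-identityʳ)
open import Data.List.Relation.Binary.Subset.Propositional using () renaming (_⊆_ to _⊆ₗ_)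
open import Data.List.Relation.Unary.Any using (here; there; index)
open import Data.List.Relation.Unary.Any.Properties using (lookup-index)
open import Data.Nat.Base using (ℕ; suc; _+_; _<_)
open import Data.Nat.Properties
  using (<-≤-trans; n<1+n; m<n⇒m<1+n; <-trans; <-irrefl; <-asym; m≤n⇒m<n∨m≡n)
open import Data.Product.Base using (∃; _×_; _,_; proj₁; proj₂)
open import Data.Sum.Base using (_⊎_; inj₁; inj₂; [_,_]′)
open import Function.Base using (id; _∘_)
open import Function.Bundles using (mk⇔; module Equivalence)
open import Relation.Binary.Bundles using (Setoid)
open import Relation.Binary.PropositionalEquality as ≡ using (_≡_; refl; subst)
open import Relation.Binary.Structures using (IsEquivalence)
import Relation.Binary.Construct.On as On
import Relation.Binary.Lattice.Bundles as OrderLattice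
import Relation.Binary.Lattice.Properties.Lattice as OrderLatticeₚ
open import Relation.Unary using (Pred; _⊆_; _∪_; _∩_; ｛_｝)

-- Phase semantics over a commutative idempotent monoid.

module Phase
  (M : IdempotentCommutativeMonoid 0ℓ 0ℓ)
  (⫫ : Pred (IdempotentCommutativeMonoid.Carrier M) 0ℓ)
  (⫫-resp : ∀ {x y} → IdempotentCommutativeMonoid._≈_ M x y → ⫫ x → ⫫ y)
  (⫫-∙ : ∀ {x y} → ⫫ x → ⫫ y → ⫫ (IdempotentCommutativeMonoid._∙_ M x y))
  (ℓ : Level)
  where

  open IdempotentCommutativeMonoid M
    using (_≈_; _∙_; assoc; comm; idem; identityˡ; identityʳ; ∙-congˡ; ∙-congʳ; sym; trans;
           commutativeSemigroup)
    renaming (Carrier to |M|)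
  open CommutativeSemigroupₚ commutativeSemigroup using (interchange)

  infix 8 _^⫫
  _^⫫ : Pred |M| 0ℓ → Pred |M| 0ℓ
  (P ^⫫) x = ∀ {p} → P p → ⫫ (x ∙ p)

  record Fact : Set₁ where
    field
      ∣_∣    : Pred |M| 0ℓ
      closed : ∣_∣ ^⫫ ^⫫ ⊆ ∣_∣
  open Fact public

  infix 4 _⊑_ _≋_
  _⊑_ : Fact → Fact → Set
  X ⊑ Y = ∣ X ∣ ⊆ ∣ Y ∣

  -- Both fields live at level 0, so the record can be placed at any `ℓ`. This lets the theorem
  -- range over the level of equality.
  record _≋_ (X Y : Fact) : Set ℓ where
    constructor _,_
    field
      to   : X ⊑ Y
      from : Y ⊑ X
  open _≋_ public

  swap : ∀ {x y} → ⫫ (x ∙ y) → ⫫ (y ∙ x)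
  swap = ⫫-resp (comm _ _)

  shift : ∀ {x y z} → ⫫ ((x ∙ y) ∙ z) → ⫫ (x ∙ (y ∙ z))
  shift = ⫫-resp (assoc _ _ _)

  unshift : ∀ {x y z} → ⫫ (x ∙ (y ∙ z)) → ⫫ ((x ∙ y) ∙ z)
  unshift = ⫫-resp (sym (assoc _ _ _))

  -- Three applications of `^⫫` amount to one, which makes every orthogonal closed.
  orth : Pred |M| 0ℓ → Fact
  orth P = record
    { ∣_∣    = P ^⫫
    ; closed = λ x∈ p∈P → x∈ (λ q∈P^⫫ → swap (q∈P^⫫ p∈P))
    }

  cl : Pred |M| 0ℓ → Fact
  cl P = orth (P ^⫫)

  ⊆-cl : ∀ P → P ⊆ ∣ cl P ∣
  ⊆-cl _ x∈P q∈ = swap (q∈ x∈P)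

  cl-least : ∀ {P} Z → P ⊆ ∣ Z ∣ → cl P ⊑ Z
  cl-least Z P⊆Z x∈ = closed Z (λ q∈ → x∈ (λ p∈P → q∈ (P⊆Z p∈P)))

  -- Closedness turns membership into tests in `⫫`, and `⫫` respects `_≈_`.
  transport : ∀ X {x y} → x ≈ y → ∣ X ∣ x → ∣ X ∣ y
  transport X x≈y x∈X = closed X (λ q∈ → ⫫-resp (∙-congʳ x≈y) (swap (q∈ x∈X)))

  infixr 7 _⊗_ _⊓_
  infixr 6 _⊔ᶠ_
  infixr 5 _⊸_
  _⊓_ _⊔ᶠ_ _⊗_ _⊸_ : Fact → Fact → Fact
  X ⊓ Y = record
    { ∣_∣    = ∣ X ∣ ∩ ∣ Y ∣
    ; closed = λ x∈ → closed X (λ q∈ → x∈ (λ p∈ → q∈ (proj₁ p∈)))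
                    , closed Y (λ q∈ → x∈ (λ p∈ → q∈ (proj₂ p∈)))
    }
  X ⊔ᶠ Y = cl (∣ X ∣ ∪ ∣ Y ∣)
  X ⊗ Y = cl (λ z → ∃ λ x → ∃ λ y → ∣ X ∣ x × ∣ Y ∣ y × z ≡ x ∙ y)
  X ⊸ Y = record
    { ∣_∣    = λ z → ∀ {x} → ∣ X ∣ x → ∣ Y ∣ (z ∙ x)
    ; closed = λ z∈ x∈X → closed Y (λ q∈ →
        unshift (z∈ (λ p∈ → swap (shift (swap (q∈ (p∈ x∈X)))))))
    }

  𝟙 𝟘 : Fact
  𝟘 = record
    { ∣_∣    = ⫫
    -- The unit of the monoid lies in `⫫ ^⫫`, and testing `x` against it gives back `x`.
    ; closed = λ x∈ → ⫫-resp (identityʳ _) (x∈ (⫫-resp (sym (identityˡ _))))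
    }
  𝟙 = orth ⫫

  ⊗-intro : ∀ X Y {x y} → ∣ X ∣ x → ∣ Y ∣ y → ∣ X ⊗ Y ∣ (x ∙ y)
  ⊗-intro X Y x∈X y∈Y = ⊆-cl _ (_ , _ , x∈X , y∈Y , refl)

  ⊗-least : ∀ X Y Z → (∀ {x y} → ∣ X ∣ x → ∣ Y ∣ y → ∣ Z ∣ (x ∙ y)) → X ⊗ Y ⊑ Z
  ⊗-least X Y Z f = cl-least Z λ { (_ , _ , x∈X , y∈Y , refl) → f x∈X y∈Y }

  ⊗-mono : ∀ X X′ Y Y′ → X ⊑ X′ → Y ⊑ Y′ → X ⊗ Y ⊑ X′ ⊗ Y′
  ⊗-mono X X′ Y Y′ f g = ⊗-least X Y (X′ ⊗ Y′) (λ x∈X y∈Y → ⊗-intro X′ Y′ (f x∈X) (g y∈Y))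

  ⊗-comm : ∀ X Y → X ⊗ Y ⊑ Y ⊗ X
  ⊗-comm X Y = ⊗-least X Y (Y ⊗ X)
    (λ x∈X y∈Y → transport (Y ⊗ X) (comm _ _) (⊗-intro Y X y∈Y x∈X))

  -- `⊗-least` opens one closure at a time. Moving `Z` across the inclusion, into the fact `Z ⊸ W`,
  -- exposes the products inside `X ⊗ Y`.
  ⊗-assocʳ : ∀ X Y Z → (X ⊗ Y) ⊗ Z ⊑ X ⊗ (Y ⊗ Z)
  ⊗-assocʳ X Y Z = ⊗-least (X ⊗ Y) Z W (λ u∈ z∈Z → step u∈ z∈Z)
    where
    W = X ⊗ (Y ⊗ Z)
    step : X ⊗ Y ⊑ Z ⊸ W
    step = ⊗-least X Y (Z ⊸ W) (λ x∈X y∈Y z∈Z →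
      transport W (sym (assoc _ _ _)) (⊗-intro X (Y ⊗ Z) x∈X (⊗-intro Y Z y∈Y z∈Z)))

  ⊗-assocˡ : ∀ X Y Z → X ⊗ (Y ⊗ Z) ⊑ (X ⊗ Y) ⊗ Z
  ⊗-assocˡ X Y Z = ⊗-least X (Y ⊗ Z) W (λ x∈X v∈ → transport W (comm _ _) (step v∈ x∈X))
    where
    W = (X ⊗ Y) ⊗ Z
    step : Y ⊗ Z ⊑ X ⊸ W
    step = ⊗-least Y Z (X ⊸ W) (λ y∈Y z∈Z x∈X →
      transport W (trans (assoc _ _ _) (comm _ _)) (⊗-intro (X ⊗ Y) Z (⊗-intro X Y x∈X y∈Y) z∈Z))

  ⊗-identityˡ : ∀ X → 𝟙 ⊗ X ⊑ X
  ⊗-identityˡ X = ⊗-least 𝟙 X X (λ u∈𝟙 x∈X → closed X (λ q∈ → unshift (u∈𝟙 (swap (q∈ x∈X)))))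

  ⊑-𝟙⊗ : ∀ X → X ⊑ 𝟙 ⊗ X
  ⊑-𝟙⊗ X x∈X = transport (𝟙 ⊗ X) (identityˡ _) (⊗-intro 𝟙 X (⫫-resp (sym (identityˡ _))) x∈X)

  -- Idempotence duplicates the test element `q`, so that `x` and `y` each meet their own copy; the
  -- two results multiply inside `⫫`.
  ⊗-contract : ∀ X → X ⊗ X ⊑ X
  ⊗-contract X = ⊗-least X X X (λ {x} {y} x∈X y∈X → closed X (λ {q} q∈ →
    ⫫-resp (merge x y q) (⫫-∙ (swap (q∈ x∈X)) (swap (q∈ y∈X)))))
    where
    merge : ∀ x y q → (x ∙ q) ∙ (y ∙ q) ≈ (x ∙ y) ∙ q
    merge x y q = trans (interchange x q y q) (∙-congˡ (idem q))

  ⊗-dup : ∀ X → X ⊑ X ⊗ X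
  ⊗-dup X x∈X = transport (X ⊗ X) (idem _) (⊗-intro X X x∈X x∈X)

  curry : ∀ X Y Z → X ⊗ Y ⊑ Z → Y ⊑ X ⊸ Z
  curry X Y Z f y∈Y x∈X = transport Z (comm _ _) (f (⊗-intro X Y x∈X y∈Y))

  uncurry : ∀ X Y Z → Y ⊑ X ⊸ Z → X ⊗ Y ⊑ Z
  uncurry X Y Z f = ⊗-least X Y Z (λ x∈X y∈Y → transport Z (comm _ _) (f y∈Y x∈X))

  ≋-isEquivalence : IsEquivalence _≋_
  ≋-isEquivalence = record
    { refl  = id , id
    ; sym   = λ X≋Y → from X≋Y , to X≋Y
    ; trans = λ X≋Y Y≋Z → (to Y≋Z ∘ to X≋Y) , (from X≋Y ∘ from Y≋Z)
    }

  lattice : OrderLattice.Lattice (lsuc 0ℓ) ℓ 0ℓ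
  lattice = record
    { Carrier   = Fact
    ; _≈_       = _≋_
    ; _≤_       = _⊑_
    ; _∨_       = _⊔ᶠ_
    ; _∧_       = _⊓_
    ; isLattice = record
      { isPartialOrder = record
        { isPreorder = record
          { isEquivalence = ≋-isEquivalence
          ; reflexive     = to
          ; trans         = λ f g → g ∘ f
          }
        ; antisym = _,_
        }
      ; supremum = λ X Y → (⊆-cl _ ∘ inj₁) , (⊆-cl _ ∘ inj₂) , λ Z f g → cl-least Z [ f , g ]′
      ; infimum  = λ X Y → proj₁ , proj₂ , λ Z f g z∈ → f z∈ , g z∈
      }
    }

  open IsLattice (OrderLatticeₚ.isAlgLattice lattice) using (∧-cong; ∨-cong)

  phaseAlgebra : Algebra (lsuc 0ℓ) ℓ
  phaseAlgebra = record
    { setoid = record { isEquivalence = ≋-isEquivalence }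
    ; _∧_    = _⊓_
    ; _∨_    = _⊔ᶠ_
    ; _∙_    = _⊗_
    ; _⇒_    = _⊸_
    ; 1#     = 𝟙
    ; 0#     = 𝟘
    ; ∧-cong = ∧-cong
    ; ∨-cong = ∨-cong
    ; ∙-cong = λ {X} {X′} {Y} {Y′} p q →
        ⊗-mono X X′ Y Y′ (to p) (to q) , ⊗-mono X′ X Y′ Y (from p) (from q)
    ; ⇒-cong = λ p q →
        (λ z∈ x∈ → to q (z∈ (from p x∈))) , (λ z∈ x∈ → from q (z∈ (to p x∈)))
    }

  phaseCIdInRL : CIdInRL phaseAlgebra
  phaseCIdInRL = record
    { isLattice                     = OrderLatticeₚ.isAlgLattice lattice
    ; isIdempotentCommutativeMonoid = record
      { isCommutativeMonoid = isCommutativeMonoidˡ record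
        { isSemigroup = record
          { isMagma = record
            { isEquivalence = ≋-isEquivalence
            ; ∙-cong        = λ {X} {X′} {Y} {Y′} → Algebra.∙-cong phaseAlgebra {X} {X′} {Y} {Y′}
            }
          ; assoc = λ X Y Z → ⊗-assocʳ X Y Z , ⊗-assocˡ X Y Z
          }
        ; identityˡ = λ X → ⊗-identityˡ X , ⊑-𝟙⊗ X
        ; comm      = λ X Y → ⊗-comm X Y , ⊗-comm Y X
        }
      ; idem = λ X → ⊗-contract X , ⊗-dup X
      }
    ; residuated = λ X Y Z → mk⇔
        (λ p → ⊑⇒≤ Y (X ⊸ Z) (curry X Y Z (≤⇒⊑ (X ⊗ Y) Z p)))
        (λ p → ⊑⇒≤ (X ⊗ Y) Z (uncurry X Y Z (≤⇒⊑ Y (X ⊸ Z) p)))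
    -- `X ⊸ 𝟘` unfolds to the orthogonal of `X`, so double negation is biorthogonal closure.
    ; involutive = λ X → closed X , ⊆-cl ∣ X ∣
    }
    where
    ≤⇒⊑ : ∀ X Y → X ≋ X ⊓ Y → X ⊑ Y
    ≤⇒⊑ X Y p x∈X = proj₂ (to p x∈X)
    ⊑⇒≤ : ∀ X Y → X ⊑ Y → X ≋ X ⊓ Y
    ⊑⇒≤ X Y f = (λ x∈X → x∈X , f x∈X) , proj₁

-- The subalgebra generated by finitely many elements.

-- Elements are terms, compared by their values in B, so that the carrier lives
-- at any chosen level.
module Generated {b ℓ} (B : Algebra b ℓ) {k : ℕ} (g : Fin k → Algebra.Carrier B) (c : Level) where
  private module B = Algebra B

  infixr 7 _∙_
  infixr 6 _∧_
  infixr 5 _∨_ _⇒_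
  data Term : Set c where
    var             : Fin k → Term
    _∧_ _∨_ _∙_ _⇒_ : Term → Term → Term
    1# 0#           : Term

  ⟦_⟧ : Term → B.Carrier
  ⟦ var i ⟧ = g i
  ⟦ s ∧ t ⟧ = ⟦ s ⟧ B.∧ ⟦ t ⟧
  ⟦ s ∨ t ⟧ = ⟦ s ⟧ B.∨ ⟦ t ⟧
  ⟦ s ∙ t ⟧ = ⟦ s ⟧ B.∙ ⟦ t ⟧
  ⟦ s ⇒ t ⟧ = ⟦ s ⟧ B.⇒ ⟦ t ⟧
  ⟦ 1# ⟧    = B.1#
  ⟦ 0# ⟧    = B.0#

  algebra : Algebra c ℓ
  algebra = record
    { setoid = On.setoid B.setoid ⟦_⟧
    ; _∧_    = _∧_
    ; _∨_    = _∨_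
    ; _∙_    = _∙_
    ; _⇒_    = _⇒_
    ; 1#     = 1#
    ; 0#     = 0#
    ; ∧-cong = B.∧-cong
    ; ∨-cong = B.∨-cong
    ; ∙-cong = B.∙-cong
    ; ⇒-cong = B.⇒-cong
    }

  finitelyGenerated : FinitelyGenerated algebra
  finitelyGenerated = tabulate var , generate
    where
    generate : ∀ t → Sg algebra (tabulate var) t
    generate (var i) = gen (∈-tabulate⁺ (Algebra.setoid algebra) i)
    generate (s ∧ t) = meet (generate s) (generate t)
    generate (s ∨ t) = join (generate s) (generate t)
    generate (s ∙ t) = mul (generate s) (generate t)
    generate (s ⇒ t) = res (generate s) (generate t)
    generate 1#      = one
    generate 0#      = zero

  generatedCIdInRL : CIdInRL B → CIdInRL algebra
  generatedCIdInRL B∈ = record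
    { isLattice = record
      { isEquivalence = Setoid.isEquivalence (Algebra.setoid algebra)
      ; ∨-comm        = λ s t → L.∨-comm ⟦ s ⟧ ⟦ t ⟧
      ; ∨-assoc       = λ s t u → L.∨-assoc ⟦ s ⟧ ⟦ t ⟧ ⟦ u ⟧
      ; ∨-cong        = B.∨-cong
      ; ∧-comm        = λ s t → L.∧-comm ⟦ s ⟧ ⟦ t ⟧
      ; ∧-assoc       = λ s t u → L.∧-assoc ⟦ s ⟧ ⟦ t ⟧ ⟦ u ⟧
      ; ∧-cong        = B.∧-cong
      ; absorptive    = (λ s t → proj₁ L.absorptive ⟦ s ⟧ ⟦ t ⟧)
                      , (λ s t → proj₂ L.absorptive ⟦ s ⟧ ⟦ t ⟧)
      }
    ; isIdempotentCommutativeMonoid = record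
      { isCommutativeMonoid = isCommutativeMonoidˡ record
        { isSemigroup = record
          { isMagma = record
            { isEquivalence = Setoid.isEquivalence (Algebra.setoid algebra)
            ; ∙-cong        = B.∙-cong
            }
          ; assoc = λ s t u → M.assoc ⟦ s ⟧ ⟦ t ⟧ ⟦ u ⟧
          }
        ; identityˡ = λ t → M.identityˡ ⟦ t ⟧
        ; comm      = λ s t → M.comm ⟦ s ⟧ ⟦ t ⟧
        }
      ; idem = λ t → M.idem ⟦ t ⟧
      }
    ; residuated = λ s t u → CIdInRL.residuated B∈ ⟦ s ⟧ ⟦ t ⟧ ⟦ u ⟧
    ; involutive = λ t → CIdInRL.involutive B∈ ⟦ t ⟧
    }
    where
    module L = IsLattice (CIdInRL.isLattice B∈)
    module M = IsIdempotentCommutativeMonoid (CIdInRL.isIdempotentCommutativeMonoid B∈)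

-- Among the first `1 + length xs` values of `t`, two are found at the same position of `xs`, so
-- they are equal.
distinct⇒¬Finite : ∀ {c ℓ} (A : Algebra c ℓ) (t : ℕ → Algebra.Carrier A) →
  (∀ {m n} → m < n → ¬ Algebra._≈_ A (t m) (t n)) → ¬ Finite A
distinct⇒¬Finite A t distinct (xs , enum)
  with i , j , i<j , eq ← pigeonhole (n<1+n (length xs)) (λ i → index (enum (t (toℕ i))))
  = distinct i<j (S.trans (lookup-index (enum (t (toℕ i))))
      (S.trans (S.reflexive (≡.cong (lookup xs) eq)) (S.sym (lookup-index (enum (t (toℕ j)))))))
  where module S = Setoid (Algebra.setoid A)

-- Token sets and the covering relation.

data Token : Set where
  lo hi : ℕ → Token

-- No number covers itself: `1 + n` covers `n` but not `1 + n`, while `n` covers `1 + n` but not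
-- `n`. So consecutive levels are incomparable, as in a Rieger-Nishimura ladder.
Covers : ℕ → ℕ → Set
Covers m n = m < n ⊎ m ≡ suc n

covers-2+ : ∀ {m n} → Covers m n → Covers m (2 + n)
covers-2+ (inj₁ m<n)  = inj₁ (m<n⇒m<1+n (m<n⇒m<1+n m<n))
covers-2+ (inj₂ refl) = inj₁ (n<1+n _)

covers-3+ : ∀ {m n} → Covers m n → Covers m (3 + n)
covers-3+ (inj₁ m<n)  = inj₁ (m<n⇒m<1+n (m<n⇒m<1+n (m<n⇒m<1+n m<n)))
covers-3+ (inj₂ refl) = inj₁ (m<n⇒m<1+n (n<1+n _))

-- The only other way for `2 + n` to cover `k` is `k ≡ 1 + n`, which `1 + n` does not cover.
covers-both⇒< : ∀ {n k} → Covers (1 + n) k → Covers (2 + n) k → 2 + n < k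
covers-both⇒< _            (inj₁ 2+n<k) = 2+n<k
covers-both⇒< (inj₁ 1+n<k) (inj₂ refl)  = ⊥-elim (<-irrefl refl 1+n<k)

Covered : List Token → ℕ → Set
Covered S n = ∃ λ m → lo m ∈ S × Covers m n

AllCovered : List Token → Set
AllCovered S = ∀ {n} → hi n ∈ S → Covered S n

-- Lists up to having the same members serve as finite sets, with `_++_` as union.
tokenSets : IdempotentCommutativeMonoid 0ℓ 0ℓ
tokenSets = record
  { isIdempotentCommutativeMonoid = record
    { isCommutativeMonoid = CommutativeMonoid.isCommutativeMonoid (commutativeMonoid set Token)
    ; idem                = ++-idempotent
    }
  }

covered-⊆ : ∀ {S T} → S ⊆ₗ T → Covered S ⊆ Covered T
covered-⊆ S⊆T (m , lo∈S , m▹n) = m , S⊆T lo∈S , m▹n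

-- A cover of `1 + n` that lies below it covers every later number too. Otherwise it is `2 + n`,
-- which reaches everything above `2 + n`; the two remaining values of `k` are the hypotheses.
covered-beyond : ∀ {S n k} → Covered S (1 + n) → Covered S (2 + n) → n < k → Covered S k
covered-beyond (m , lo∈S , inj₁ m<1+n) _ n<k = m , lo∈S , inj₁ (<-≤-trans m<1+n n<k)
covered-beyond c₁@(_ , lo∈S , inj₂ refl) c₂ n<k with m≤n⇒m<n∨m≡n n<k
... | inj₂ refl = c₁
... | inj₁ 1+n<k with m≤n⇒m<n∨m≡n 1+n<k
...   | inj₂ refl  = c₂
...   | inj₁ 2+n<k = _ , lo∈S , inj₁ 2+n<k

covered-++ˡ : ∀ {S T} → Covered S ⊆ Covered (S ++ T)
covered-++ˡ = covered-⊆ ∈-++⁺ˡ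

covered-++ʳ : ∀ S {T} → Covered T ⊆ Covered (S ++ T)
covered-++ʳ S = covered-⊆ (∈-++⁺ʳ S)

allCovered-++ : ∀ {S T} → AllCovered S → AllCovered T → AllCovered (S ++ T)
allCovered-++ {S} S✓ T✓ hi∈ = [ covered-++ˡ ∘ S✓ , covered-++ʳ S ∘ T✓ ]′ (∈-++⁻ S hi∈)

covered-++-hi : ∀ {S n k} → Covered (S ++ [ hi n ]) k → Covered S k
covered-++-hi {S} (m , lo∈ , m▹k) with ∈-++⁻ S lo∈
... | inj₁ lo∈S        = m , lo∈S , m▹k
... | inj₂ (here ())
... | inj₂ (there ())

covered-++-lo : ∀ {S m n} → Covered (S ++ [ lo m ]) n → Covered S n ⊎ Covers m n
covered-++-lo {S} (m , lo∈ , m▹n) with ∈-++⁻ S lo∈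
... | inj₁ lo∈S        = inj₁ (m , lo∈S , m▹n)
... | inj₂ (here refl) = inj₂ m▹n

-- The ladder of facts `Z n`.

module Ladder (ℓ : Level) where
  open Phase tokenSets AllCovered
    (λ S≈T S✓ hi∈T → covered-⊆ (Equivalence.to S≈T) (S✓ (Equivalence.from S≈T hi∈T)))
    (λ {S} → allCovered-++ {S}) ℓ public

  Z : ℕ → Fact
  Z n = orth ｛ [ hi n ] ｝

  Z-intro : ∀ {S n} → AllCovered S → Covered S n → ∣ Z n ∣ S
  Z-intro {S} S✓ S▹n refl hi∈ with ∈-++⁻ S hi∈
  ... | inj₁ hi∈S        = covered-++ˡ (S✓ hi∈S)
  ... | inj₂ (here refl) = covered-++ˡ S▹n

  Z⇒allCovered : ∀ {S} n → ∣ Z n ∣ S → AllCovered S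
  Z⇒allCovered n S∈ hi∈ = covered-++-hi (S∈ refl (∈-++⁺ˡ hi∈))

  Z⇒covered : ∀ {S} n → ∣ Z n ∣ S → Covered S n
  Z⇒covered {S} n S∈ = covered-++-hi (S∈ refl (∈-++⁺ʳ S (here refl)))

  lo∈Z : ∀ {m n} → Covers m n → ∣ Z n ∣ [ lo m ]
  lo∈Z m▹n = Z-intro (λ { (here ()) ; (there ()) }) (_ , here refl , m▹n)

  lo∈Z⇒covers : ∀ {m n} → ∣ Z n ∣ [ lo m ] → Covers m n
  lo∈Z⇒covers {n = n} lo∈ with _ , here refl , m▹n ← Z⇒covered n lo∈ = m▹n

  Z-mono : ∀ {n k} → (∀ {m} → Covers m n → Covers m k) → Z n ⊑ Z k
  Z-mono {n} f S∈ with m , lo∈S , m▹n ← Z⇒covered n S∈ =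
    Z-intro (Z⇒allCovered n S∈) (m , lo∈S , f m▹n)

  step : ℕ → Fact
  step n = Z n ⊔ᶠ Z (1 + n)

  step⊑Z : ∀ n → step n ⊑ Z (3 + n)
  step⊑Z n = cl-least (Z (3 + n)) [ Z-mono covers-3+ , Z-mono covers-2+ ]′

  -- Test T against {lo (1 + n)} in Z n and {lo (2 + n)} in Z (1 + n): a hi k in T
  -- that T itself leaves uncovered has k > 2 + n.
  Z⊓Z⊑step : ∀ n → Z (3 + n) ⊓ Z (4 + n) ⊑ step n
  Z⊓Z⊑step n {S} (S∈₃ , S∈₄) {T} T∈ hi∈ with ∈-++⁻ S hi∈
  ... | inj₁ hi∈S = covered-++ˡ (Z⇒allCovered (3 + n) S∈₃ hi∈S)
  ... | inj₂ hi∈T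
    with covered-++-lo {T} (T∈ (inj₁ (lo∈Z {1 + n} (inj₂ refl))) (∈-++⁺ˡ hi∈T))
       | covered-++-lo {T} (T∈ (inj₂ (lo∈Z {2 + n} (inj₂ refl))) (∈-++⁺ˡ hi∈T))
  ... | inj₁ T▹k | _        = covered-++ʳ S T▹k
  ... | inj₂ _   | inj₁ T▹k = covered-++ʳ S T▹k
  ... | inj₂ c   | inj₂ c′  = covered-++ˡ
    (covered-beyond (Z⇒covered (3 + n) S∈₃) (Z⇒covered (4 + n) S∈₄) (covers-both⇒< c c′))

  ladder : ∀ n → 𝟙 ⊓ (Z (2 + n) ⊸ step n) ≋ Z (3 + n)
  ladder n = down , up
    where
    down : 𝟙 ⊓ (Z (2 + n) ⊸ step n) ⊑ Z (3 + n)
    down {S} (S∈𝟙 , S∈⊸) = Z-intro S✓ S▹3+n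
      where
      S✓ : AllCovered S
      -- The unit is tested on the empty set, which has no `hi` to cover.
      S✓ = subst AllCovered (++-identityʳ S) (S∈𝟙 λ ())
      S▹3+n : Covered S (3 + n)
      -- The probe `lo (3 + n)` covers `2 + n` but not `3 + n`, so the cover of `3 + n` found in the
      -- union must come from `S`.
      S▹3+n with covered-++-lo {S} (Z⇒covered (3 + n) (step⊑Z n (S∈⊸ (lo∈Z {3 + n} (inj₂ refl)))))
      ... | inj₁ c           = c
      ... | inj₂ (inj₁ 3+n<) = ⊥-elim (<-irrefl refl 3+n<)
    up : Z (3 + n) ⊑ 𝟙 ⊓ (Z (2 + n) ⊸ step n)
    -- The union `S ++ T` is in `Z (3 + n)` because of `S`, and in `Z (4 + n)` because of `T`, as
    -- `Z (2 + n) ⊑ Z (4 + n)`.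
    up {S} S∈ = (λ T✓ → allCovered-++ {S} S✓ T✓) , λ {T} T∈ →
      let ST✓ = allCovered-++ {S} S✓ (Z⇒allCovered {T} (2 + n) T∈) in
      Z⊓Z⊑step n
        ( Z-intro ST✓ (covered-++ˡ (Z⇒covered (3 + n) S∈))
        , Z-intro ST✓ (covered-++ʳ S (Z⇒covered (4 + n) (Z-mono covers-2+ T∈))))
      where
      S✓ : AllCovered S
      S✓ = Z⇒allCovered (3 + n) S∈

  Z-distinct : ∀ {n k} → n < k → ¬ Z n ≋ Z k
  Z-distinct {n} n<k p with lo∈Z⇒covers {n = n} (from p (lo∈Z (inj₂ refl)))
  ... | inj₁ 1+k<n = <-asym n<k (<-trans (n<1+n _) 1+k<n)
  ... | inj₂ refl  = <-irrefl refl n<k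

-- Failure of local finiteness.

proposition7p3 : ∀ (c ℓ : Level) → ¬ LocallyFinite (CIdInRL {c} {ℓ})
proposition7p3 c ℓ locallyFinite =
  distinct⇒¬Finite algebra t t-distinct
    (locallyFinite algebra (generatedCIdInRL phaseCIdInRL) finitelyGenerated)
  where
  open Ladder ℓ
  open Generated phaseAlgebra {3} (Z ∘ toℕ) c
  open Algebra phaseAlgebra using (setoid; ∧-cong; ∨-cong; ⇒-cong)
  module S = Setoid setoid

  t : ℕ → Term
  t 0                       = var 0F
  t 1                       = var 1F
  t 2                       = var 2F
  -- Here `l` is `2 + n` and `m` is `1 + n`: this is the left side of `ladder`, built from the three
  -- preceding terms.
  t (suc l@(suc m@(suc n))) = 1# ∧ (t l ⇒ (t n ∨ t m))

  ⟦t⟧≋Z : ∀ n → ⟦ t n ⟧ ≋ Z n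
  ⟦t⟧≋Z 0 = S.refl
  ⟦t⟧≋Z 1 = S.refl
  ⟦t⟧≋Z 2 = S.refl
  ⟦t⟧≋Z (suc l@(suc m@(suc n))) = S.trans
    (∧-cong (S.refl {𝟙}) (⇒-cong (⟦t⟧≋Z l) (∨-cong (⟦t⟧≋Z n) (⟦t⟧≋Z m))))
    (ladder n)

  t-distinct : ∀ {m n} → m < n → ¬ ⟦ t m ⟧ ≋ ⟦ t n ⟧
  t-distinct {m} {n} m<n p = Z-distinct m<n (S.trans (S.sym (⟦t⟧≋Z m)) (S.trans p (⟦t⟧≋Z n)))
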